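{- Let $\tilde{G}=(\tilde{Q},\tilde{E},\tilde{\delta},\tilde{q}_0)$ be a fuzzy discrete event system with uncontrollability degrees $\tilde{E}_{uc}:\tilde{E}\to[0,1]$, and let $P$ be a nonempty subset of $\tilde{Q}$. Then there exists a fuzzy state feedback controller $f$ for $\tilde{G}$ such that $R(\tilde{G}^f)=P$ if and only if $P$ is controllable with respect to $\tilde{G}$ and $\tilde{E}_{uc}$.
   Context: Notation: $\wedge,\vee$ denote infimum (minimum) and supremum (maximum) in $[0,1]$. Fix $n\ge1$. $\tilde{Q}$ is the set of fuzzy states: all row vectors in $[0,1]^n$ other than the zero vector. A fuzzy event is an $n\times n$ matrix over $[0,1]$; $\tilde{E}$ is a finite set of fuzzy events; $\tilde{q}_0\in\tilde{Q}$ is the initial state. $\tilde{E}^*$ is the set of finite strings over $\tilde{E}$, with empty string $\epsilon$. The max-min composition is $(A\circ B)_{ij}=\bigvee_l(a_{il}\wedge b_{lj})$. For $\lambda\in[0,1]$ and a vector $x$, $\lambda\cdot x$ is the vector with entries $\lambda\wedge x_i$. The (partial) transition function is $\tilde{\delta}(\tilde{q},\tilde{a})=\tilde{q}\circ\tilde{a}$, regarded as undefined when $\tilde{q}\circ\tilde{a}$ is the zero vector. Each $\tilde{a}\in\tilde{E}$ has an uncontrollability degree $\tilde{E}_{uc}(\tilde{a})\in[0,1]$. A fuzzy state feedback controller (FSFC) for $\tilde{G}$ is a map $f$ assigning to each $\tilde{q}\in\tilde{Q}$ a function $f(\tilde{q}):\tilde{E}\to[0,1]$ with $f(\tilde{q})(\tilde{a})\ge\tilde{E}_{uc}(\tilde{a})$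 for all $\tilde{q},\tilde{a}$. The closed-loop system is $\tilde{G}^f=(\tilde{Q},\tilde{E},\tilde{\delta}^f,\tilde{q}_0)$ with $\tilde{\delta}^f(\tilde{q},\tilde{a})=f(\tilde{q})(\tilde{a})\cdot(\tilde{q}\circ\tilde{a})$, undefined when this is the zero vector, extended to strings by $\tilde{\delta}^f(\tilde{q},\epsilon)=\tilde{q}$, $\tilde{\delta}^f(\tilde{q},\tilde{s}\tilde{a})=\tilde{\delta}^f(\tilde{\delta}^f(\tilde{q},\tilde{s}),\tilde{a})$. $R(\tilde{G}^f)$ is the set of $\tilde{q}\in\tilde{Q}$ with $\tilde{q}=\tilde{\delta}^f(\tilde{q}_0,\tilde{s})$ for some $\tilde{s}\in\tilde{E}^*$. Controllability of a state set. Let $P\subseteq\tilde{Q}$. For $\tilde{q}\in P$ the successor set of $\tilde{q}$ in $P$ is $$\mathrm{Succ}(\tilde{q})=\{(\tilde{a},\tilde{p}):\tilde{a}\in\tilde{E},\ \tilde{p}\in P,\ \exists\,\alpha\in[0,1],\ \alpha\ge\tilde{E}_{uc}(\tilde{a}),\ \alpha\cdot(\tilde{q}\circ\tilde{a})=\tilde{p}\}.$$ A subset $C(\tilde{q})\subseteq\mathrm{Succ}(\tilde{q})$ is compatible if: (C1) for any $(\tilde{a}_1,\tilde{p}_1),(\tilde{a}_2,\tilde{p}_2)\in C(\tilde{q})$, $\tilde{a}_1=\tilde{a}_2$ implies $\tilde{p}_1=\tilde{p}_2$; (C2) if $\tilde{a}\in\tilde{E}$ with $\tilde{E}_{uc}(\tilde{a})>0$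 and $\tilde{q}\circ\tilde{a}\ne0$, then $(\tilde{a},\tilde{p})\in C(\tilde{q})$ for some $\tilde{p}\in P$. The set $P$ is controllable (with respect to $\tilde{G}$ and $\tilde{E}_{uc}$) if one can select for each $\tilde{q}\in P$ a compatible subset $C(\tilde{q})$ of $\mathrm{Succ}(\tilde{q})$ such that for each $\tilde{p}\in P$ there exist an integer $k\ge0$ and a sequence $(\tilde{q}_0,\tilde{a}_1,\tilde{q}_1,\tilde{a}_2,\ldots,\tilde{a}_k,\tilde{q}_k=\tilde{p})$, starting at the initial state $\tilde{q}_0$, with $\tilde{q}_{i-1}\in P$ and $(\tilde{a}_i,\tilde{q}_i)\in C(\tilde{q}_{i-1})$ for $i=1,\ldots,k$. -}

module Defs where

open import Data.Fin using (Fin; zero; suc; inject₁; fromℕ)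
open import Data.List using (List; []; _∷ʳ_)
open import Data.Nat using (ℕ)
open import Data.Product using (∃; ∃-syntax; _×_; _,_; proj₁; proj₂)
open import Data.Rational as ℚ using (ℚ; 0ℚ; 1ℚ)
import Data.Rational.Properties as ℚ
open import Data.Sum using (inj₁; inj₂; [_,_])
open import Data.Vec.Functional using (Vector; foldr)
open import Data.Vec.Functional.Relation.Binary.Pointwise using (Pointwise)
open import Function using (id)
open import Level using (0ℓ) renaming (suc to lsuc)
open import Relation.Binary.Core using (Rel)
open import Relation.Binary.Definitions using (tri<; tri≈; tri>)
open import Relation.Binary.Lattice using (IsBoundedLattice)
import Relation.Binary.Construct.NonStrictToStrict as NonStrictToStrict
open import Relation.Binary.PropositionalEquality using (_≡_; refl)
open import Relation.Nullary using (¬_)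
open import Relation.Unary using (Pred; _∈_; _⊆_; _∪_; _∩_)

-- A real x in [0,1] is the Dedekind cut {q ∈ ℚ | q < x}: a lower set of
-- rationals without a greatest element, containing every q < 0 and bounded
-- by 1. One-sided cuts give the real numbers only in the presence of excluded
-- middle; without it they are the (more general) lower reals.

record 𝕀 : Set₁ where
  field
    cut     : Pred ℚ 0ℓ
    lower   : ∀ {q r} → q ℚ.< r → r ∈ cut → q ∈ cut
    rounded : ∀ {q} → q ∈ cut → ∃[ r ] q ℚ.< r × r ∈ cut
    0≤      : ∀ {q} → q ℚ.< 0ℚ → q ∈ cut
    ≤1      : ∀ {q} → q ∈ cut → q ℚ.< 1ℚ

open 𝕀 public using (cut)

infix 4 _≤_ _≈_

_≤_ : Rel 𝕀 0ℓ
x ≤ y = cut x ⊆ cut y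

_≈_ : Rel 𝕀 0ℓ
x ≈ y = x ≤ y × y ≤ x

open NonStrictToStrict _≈_ _≤_ public using (_<_)

0𝕀 : 𝕀
0𝕀 = record
  { cut     = ℚ._< 0ℚ
  ; lower   = ℚ.<-trans
  ; rounded = ℚ.<-dense
  ; 0≤      = id
  ; ≤1      = λ q<0 → ℚ.<-trans q<0 (ℚ.positive⁻¹ 1ℚ)
  }

1𝕀 : 𝕀
1𝕀 = record
  { cut     = ℚ._< 1ℚ
  ; lower   = ℚ.<-trans
  ; rounded = ℚ.<-dense
  ; 0≤      = λ q<0 → ℚ.<-trans q<0 (ℚ.positive⁻¹ 1ℚ)
  ; ≤1      = id
  }

infixr 7 _∧_
infixr 6 _∨_

_∨_ : 𝕀 → 𝕀 → 𝕀
x ∨ y = record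
  { cut     = cut x ∪ cut y
  ; lower   = λ q<r → [ (λ r∈x → inj₁ (X.lower q<r r∈x))
                      , (λ r∈y → inj₂ (Y.lower q<r r∈y)) ]
  ; rounded = [ (λ q∈x → let r , q<r , r∈x = X.rounded q∈x in r , q<r , inj₁ r∈x)
              , (λ q∈y → let r , q<r , r∈y = Y.rounded q∈y in r , q<r , inj₂ r∈y) ]
  ; 0≤      = λ q<0 → inj₁ (X.0≤ q<0)
  ; ≤1      = [ X.≤1 , Y.≤1 ]
  }
  where
  module X = 𝕀 x
  module Y = 𝕀 y

_∧_ : 𝕀 → 𝕀 → 𝕀
x ∧ y = record
  { cut     = cut x ∩ cut y
  ; lower   = λ q<r (r∈x , r∈y) → X.lower q<r r∈x , Y.lower q<r r∈y
  ; rounded = rounded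
  ; 0≤      = λ q<0 → X.0≤ q<0 , Y.0≤ q<0
  ; ≤1      = λ (q∈x , _) → X.≤1 q∈x
  }
  where
  module X = 𝕀 x
  module Y = 𝕀 y

  rounded : ∀ {q} → q ∈ cut x ∩ cut y → ∃[ r ] q ℚ.< r × r ∈ cut x ∩ cut y
  rounded (q∈x , q∈y) with X.rounded q∈x | Y.rounded q∈y
  ... | r , q<r , r∈x | s , q<s , s∈y with ℚ.<-cmp r s
  ...   | tri< r<s _ _    = r , q<r , r∈x , Y.lower r<s s∈y
  ...   | tri≈ _ refl _   = r , q<r , r∈x , s∈y
  ...   | tri> _ _ s<r    = s , q<s , X.lower s<r r∈x , s∈y

∨-∧-isBoundedLattice : IsBoundedLattice _≈_ _≤_ _∨_ _∧_ 1𝕀 0𝕀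
∨-∧-isBoundedLattice = record
  { isLattice = record
    { isPartialOrder = record
      { isPreorder = record
        { isEquivalence = record
          { refl  = id , id
          ; sym   = λ (x≤y , y≤x) → y≤x , x≤y
          ; trans = λ (x≤y , y≤x) (y≤z , z≤y) →
                      (λ q∈x → y≤z (x≤y q∈x)) , (λ q∈z → y≤x (z≤y q∈z))
          }
        ; reflexive = proj₁
        ; trans     = λ x≤y y≤z q∈x → y≤z (x≤y q∈x)
        }
      ; antisym = _,_
      }
    ; supremum = λ _ _ → inj₁ , inj₂ , λ _ x≤z y≤z → [ x≤z , y≤z ]
    ; infimum  = λ _ _ → proj₁ , proj₂ , λ _ z≤x z≤y q∈z → z≤x q∈z , z≤y q∈z
    }
  ; maximum = λ x → 𝕀.≤1 x
  ; minimum = λ x → 𝕀.0≤ x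
  }

Matrix : ℕ → Set₁
Matrix n = Vector (Vector 𝕀 n) n

infix 4 _≋_ _≋ₘ_

_≋_ : ∀ {n} → Rel (Vector 𝕀 n) 0ℓ
_≋_ = Pointwise _≈_

_≋ₘ_ : ∀ {n} → Rel (Matrix n) 0ℓ
_≋ₘ_ = Pointwise _≋_

IsZero : ∀ {n} → Pred (Vector 𝕀 n) 0ℓ
IsZero x = ∀ i → x i ≈ 0𝕀

⋁ : ∀ {n} → Vector 𝕀 n → 𝕀
⋁ = foldr _∨_ 0𝕀

infixl 8 _∘_
infixr 7 _·_

_∘_ : ∀ {n} → Vector 𝕀 n → Matrix n → Vector 𝕀 n
(x ∘ A) j = ⋁ λ l → x l ∧ A l j

_·_ : ∀ {n} → 𝕀 → Vector 𝕀 n → Vector 𝕀 n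
(α · x) i = α ∧ x i

record State (n : ℕ) : Set₁ where
  constructor _,_
  field
    vec     : Vector 𝕀 n
    nonzero : ¬ IsZero vec

open State public using (vec)

infix 4 _≈ₛ_

_≈ₛ_ : ∀ {n} → Rel (State n) 0ℓ
p ≈ₛ q = vec p ≋ vec q

-- The transition function is determined by the events, so it is not a field.

record FuzzyDES (n : ℕ) : Set₁ where
  field
    #events  : ℕ
    matrix   : Fin #events → Matrix n
    distinct : ∀ {a b} → matrix a ≋ₘ matrix b → a ≡ b
    q₀       : State n

  Event : Set
  Event = Fin #events

  -- The graph of the partial function δ: as p ranges over nonzero vectors,
  -- there is no p with δ q a p when vec q ∘ matrix a is zero.
  δ : State n → Event → State n → Set
  δ q a p = vec p ≋ vec q ∘ matrix a

module _ {n : ℕ} (G : FuzzyDES n) (Euc : FuzzyDES.Event G → 𝕀) where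

  open FuzzyDES G

  record FSFC : Set₁ where
    field
      degree     : State n → Event → 𝕀
      cong       : ∀ {p q} → p ≈ₛ q → ∀ a → degree p a ≈ degree q a
      admissible : ∀ q a → Euc a ≤ degree q a

  module ClosedLoop (f : FSFC) where

    open FSFC f

    δᶠ : State n → Event → State n → Set
    δᶠ q a p = vec p ≋ degree q a · (vec q ∘ matrix a)

    data δᶠ* (q : State n) : List Event → State n → Set₁ where
      empty : ∀ {p} → p ≈ₛ q → δᶠ* q [] p
      snoc  : ∀ {s r a p} → δᶠ* q s r → δᶠ r a p → δᶠ* q (s ∷ʳ a) p

    Reachable : Pred (State n) (lsuc 0ℓ)
    Reachable p = ∃[ s ] δᶠ* q₀ s p

  module _ (P : Pred (State n) (lsuc 0ℓ)) where

    Succ : State n → Pred (Event × State n) (lsuc 0ℓ)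
    Succ q (a , p) =
      p ∈ P × ∃[ α ] Euc a ≤ α × α · (vec q ∘ matrix a) ≋ vec p

    record Compatible (q : State n) (C : Pred (Event × State n) (lsuc 0ℓ)) :
                      Set₁ where
      field
        ⊆Succ : C ⊆ Succ q
        C1    : ∀ {a₁ a₂ p₁ p₂} → (a₁ , p₁) ∈ C → (a₂ , p₂) ∈ C →
                a₁ ≡ a₂ → p₁ ≈ₛ p₂
        C2    : ∀ a → 0𝕀 < Euc a → ¬ IsZero (vec q ∘ matrix a) →
                ∃[ p ] p ∈ P × (a , p) ∈ C

    record Path (C : State n → Pred (Event × State n) (lsuc 0ℓ))
                (p : State n) : Set₁ where
      field
        k      : ℕ
        state  : Fin (ℕ.suc k) → State n
        event  : Fin k → Event
        start  : state zero ≈ₛ q₀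
        end    : state (fromℕ k) ≈ₛ p
        source : ∀ i → state (inject₁ i) ∈ P
        step   : ∀ i → (event i , state (suc i)) ∈ C (state (inject₁ i))

    record Controllable : Set₂ where
      field
        C          : State n → Pred (Event × State n) (lsuc 0ℓ)
        -- C is a family of subsets of the setoid of states, indexed by it.
        C-resp     : ∀ {q q′ a p p′} → q ≈ₛ q′ → p ≈ₛ p′ →
                     (a , p) ∈ C q → (a , p′) ∈ C q′
        compatible : ∀ {q} → q ∈ P → Compatible q (C q)
        path       : ∀ {p} → p ∈ P → Path C p

{-# OPTIONS --safe #-}
-- From a controller f take C(q) to be the closed-loop transitions at q.
-- Conversely, a selection C may be realised at (q, a) by several degrees α.
-- Their supremum joined with Euc(a) is a canonical one: it needs no choice, and
-- since meets distribute over suprema, (C1) makes it lead to the selected state;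
-- (C2) ensures that no transition outside C is enabled.
module Submission where

open import Defs
open import Axiom.ExcludedMiddle using (ExcludedMiddle)
open import Data.Empty using (⊥-elim)
open import Data.Fin using (Fin; zero; suc; inject₁; fromℕ)
open import Data.List using (_∷ʳ_)
open import Data.Nat using (ℕ; NonZero)
open import Data.Product using (∃-syntax; _×_; _,_; proj₁; proj₂)
open import Data.Rational as ℚ using (ℚ; 0ℚ)
import Data.Rational.Properties as ℚ
open import Data.Sum using (_⊎_; inj₁; inj₂; [_,_])
open import Data.Vec.Functional using (Vector; _∷_; head; tail)
import Data.Vec.Functional.Relation.Binary.Pointwise.Properties as Pointwise
open import Function using (id)
open import Function.Bundles using (_⇔_; mk⇔)
open import Level using (0ℓ) renaming (suc to lsuc)
open import Relation.Binary.Bundles using (Setoid)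
open import Relation.Binary.Definitions using (_Respects_)
open import Relation.Binary.Lattice using (IsBoundedLattice)
open import Relation.Binary.PropositionalEquality using (refl)
open import Relation.Nullary using (¬_; yes; no)
open import Relation.Nullary.Decidable using (True; toWitness; fromWitness)
open import Relation.Unary using (Pred; _∈_; Satisfiable; _≐_)

private variable
  n : ℕ

-- Equality of fuzzy vectors and monotonicity of the operations.

𝕀-setoid : Setoid (lsuc 0ℓ) 0ℓ
𝕀-setoid = record
  { isEquivalence = IsBoundedLattice.isEquivalence ∨-∧-isBoundedLattice }

-- Arguments are explicit because _≋_ unfolds too far for them to be inferred.
≋-refl : (x : Vector 𝕀 n) → x ≋ x
≋-refl x = Setoid.refl (Pointwise.setoid 𝕀-setoid _) {x}

≋-sym : (x y : Vector 𝕀 n) → x ≋ y → y ≋ x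
≋-sym x y = Setoid.sym (Pointwise.setoid 𝕀-setoid _) {x} {y}

≋-trans : (x y z : Vector 𝕀 n) → x ≋ y → y ≋ z → x ≋ z
≋-trans x y z = Setoid.trans (Pointwise.setoid 𝕀-setoid _) {x} {y} {z}

∧-mono : ∀ x y u v → x ≤ y → u ≤ v → x ∧ u ≤ y ∧ v
∧-mono x y u v x≤y u≤v (r∈x , r∈u) = x≤y r∈x , u≤v r∈u

⋁-mono : (x y : Vector 𝕀 n) → (∀ i → x i ≤ y i) → ⋁ x ≤ ⋁ y
⋁-mono {ℕ.zero}  x y x≤y r<0        = r<0
⋁-mono {ℕ.suc n} x y x≤y (inj₁ r∈x) = inj₁ (x≤y zero r∈x)
⋁-mono {ℕ.suc n} x y x≤y (inj₂ r∈⋁) =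
  inj₂ (⋁-mono (tail x) (tail y) (λ i → x≤y (suc i)) r∈⋁)

∘-congˡ : (x y : Vector 𝕀 n) (A : Matrix n) → x ≋ y → x ∘ A ≋ y ∘ A
∘-congˡ x y A x≋y j = mono x y (λ i → proj₁ (x≋y i)) , mono y x (λ i → proj₂ (x≋y i))
  where
  mono : ∀ u v → (∀ i → u i ≤ v i) → (u ∘ A) j ≤ (v ∘ A) j
  mono u v u≤v = ⋁-mono (λ l → u l ∧ A l j) (λ l → v l ∧ A l j)
    (λ l → ∧-mono (u l) (v l) (A l j) (A l j) (u≤v l) id)

·-cong : (α β : 𝕀) (x y : Vector 𝕀 n) → α ≈ β → x ≋ y → α · x ≋ β · y
·-cong α β x y (α≤β , β≤α) x≋y i =
  ∧-mono α β (x i) (y i) α≤β (proj₁ (x≋y i)) ,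
  ∧-mono β α (y i) (x i) β≤α (proj₂ (x≋y i))

-- Zero and positive degrees.

0∈cut : ∀ x {r} → 0ℚ ℚ.≤ r → r ∈ cut x → 0ℚ ∈ cut x
0∈cut x 0≤r r∈x with 𝕀.rounded x r∈x
... | s , r<s , s∈x = 𝕀.lower x (ℚ.≤-<-trans 0≤r r<s) s∈x

-- A cut with any nonnegative element contains 0, so that single membership separates positive
-- degrees from zero.
0∉cut⇒≤0 : ∀ x → ¬ (0ℚ ∈ cut x) → x ≤ 0𝕀
0∉cut⇒≤0 x 0∉x {r} r∈x with r ℚ.<? 0ℚ
... | yes r<0 = r<0
... | no  r≮0 = ⊥-elim (0∉x (0∈cut x (ℚ.≮⇒≥ r≮0) r∈x))

≤0⇒IsZero : (x : Vector 𝕀 n) → (∀ i → x i ≤ 0𝕀) → IsZero x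
≤0⇒IsZero x x≤0 i = x≤0 i , 𝕀.0≤ (x i)

-- If `α · x` is zero, 0 cannot lie in both `cut α` and `cut (x i)`; since `α` is positive, it then
-- lies in no `cut (x i)`.
·-nonzero : (α : 𝕀) (x : Vector 𝕀 n) → 0𝕀 < α → ¬ IsZero x → ¬ IsZero (α · x)
·-nonzero α x (0≤α , 0≉α) x≉0 αx≈0 =
  x≉0 (≤0⇒IsZero x λ i → 0∉cut⇒≤0 (x i) λ 0∈xᵢ →
    0≉α (0≤α , 0∉cut⇒≤0 α λ 0∈α →
      ℚ.<-irrefl refl (proj₁ (αx≈0 i) (0∈α , 0∈xᵢ))))

<-≤-trans : ∀ x y → 0𝕀 < x → x ≤ y → 0𝕀 < y
<-≤-trans x y (_ , 0≉x) x≤y =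
  𝕀.0≤ y , λ (_ , y≤0) → 0≉x (𝕀.0≤ x , λ r∈x → y≤0 (x≤y r∈x))

-- Suprema of sets of degrees.

module Supremum (em : ExcludedMiddle (lsuc 0ℓ)) where

  -- Cuts are small, so the quantification over 𝕀 is resized to a truth value.
  sup : Pred 𝕀 (lsuc 0ℓ) → 𝕀
  sup S = record
    { cut     = λ r → r ℚ.< 0ℚ ⊎ True (em {Below r})
    ; lower   = λ q<r → [ (λ r<0 → inj₁ (ℚ.<-trans q<r r<0))
                        , (λ t → let x , x∈S , r∈x = toWitness t in
                             inj₂ (fromWitness (x , x∈S , 𝕀.lower x q<r r∈x))) ]
    ; rounded = [ (λ q<0 → let r , q<r , r<0 = ℚ.<-dense q<0 in r , q<r , inj₁ r<0)
                , (λ t → let x , x∈S , q∈x = toWitness t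
                             r , q<r , r∈x = 𝕀.rounded x q∈x in
                     r , q<r , inj₂ (fromWitness (x , x∈S , r∈x))) ]
    ; 0≤      = inj₁
    ; ≤1      = [ 𝕀.≤1 0𝕀
                , (λ t → let x , _ , q∈x = toWitness t in 𝕀.≤1 x q∈x) ]
    }
    where
    Below : Pred ℚ (lsuc 0ℓ)
    Below r = ∃[ x ] x ∈ S × r ∈ cut x

  sup-upper : ∀ S x → x ∈ S → x ≤ sup S
  sup-upper S x x∈S r∈x = inj₂ (fromWitness (x , x∈S , r∈x))

  -- A nonnegative `r` in the supremum already lies in a single member `x`, hence in `x ∧ y`. The
  -- negative `r`, which make an empty supremum 0, lie in every cut.
  sup-∧-least : ∀ S y z → (∀ x → x ∈ S → x ∧ y ≤ z) → sup S ∧ y ≤ z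
  sup-∧-least S y z S∧y≤z (inj₁ r<0 , r∈y) = 𝕀.0≤ z r<0
  sup-∧-least S y z S∧y≤z (inj₂ t   , r∈y) =
    let x , x∈S , r∈x = toWitness t in S∧y≤z x x∈S (r∈x , r∈y)

  sup-least : ∀ S z → (∀ x → x ∈ S → x ≤ z) → sup S ≤ z
  sup-least S z S≤z r∈sup = sup-∧-least S 1𝕀 z
    (λ x x∈S (r∈x , _) → S≤z x x∈S r∈x) (r∈sup , 𝕀.≤1 (sup S) r∈sup)

module _ {n : ℕ} (G : FuzzyDES n) (Euc : FuzzyDES.Event G → 𝕀)
         (P : Pred (State n) (lsuc 0ℓ)) (P-resp : P Respects _≈ₛ_) where

  open FuzzyDES G

  -- Moving the initial state lets `Path` describe path segments that begin anywhere.
  startingAt : State n → FuzzyDES n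
  startingAt q = record G { q₀ = q }

  -- From a controller to a selection.

  module FromController (f : FSFC G Euc) (R≐P : ClosedLoop.Reachable G Euc f ≐ P) where

    open FSFC f
    open ClosedLoop G Euc f

    C : State n → Pred (Event × State n) (lsuc 0ℓ)
    C q (a , p) = p ∈ P × δᶠ q a p

    C-resp : ∀ {q q′ a p p′} → q ≈ₛ q′ → p ≈ₛ p′ → (a , p) ∈ C q → (a , p′) ∈ C q′
    C-resp {q} {q′} {a} {p} {p′} q≈q′ p≈p′ (p∈P , p≋) =
      P-resp {p} {p′} p≈p′ p∈P ,
      ≋-trans (vec p′) (vec p) y (≋-sym (vec p) (vec p′) p≈p′)
        (≋-trans (vec p) x y p≋
          (·-cong (degree q a) (degree q′ a) (vec q ∘ matrix a) (vec q′ ∘ matrix a)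
            (cong {q} {q′} q≈q′ a) (∘-congˡ (vec q) (vec q′) (matrix a) q≈q′)))
      where
      x = degree q a · (vec q ∘ matrix a)
      y = degree q′ a · (vec q′ ∘ matrix a)

    P-closed : ∀ {q a p} → q ∈ P → δᶠ q a p → p ∈ P
    P-closed {q} {a} {p} q∈P q→p =
      let s , q₀→q = proj₂ R≐P q∈P in
      proj₁ R≐P (s ∷ʳ a , snoc {q₀} {s} {q} {a} {p} q₀→q q→p)

    compatible : ∀ {q} → q ∈ P → Compatible G Euc P q (C q)
    compatible {q} q∈P = record
      { ⊆Succ = λ { {a , p} (p∈P , p≋) →
          p∈P , degree q a , admissible q a ,
          ≋-sym (vec p) (degree q a · (vec q ∘ matrix a)) p≋ }
      ; C1    = λ { {a} {_} {p₁} {p₂} (_ , p₁≋) (_ , p₂≋) refl →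
          let x = degree q a · (vec q ∘ matrix a) in
          ≋-trans (vec p₁) x (vec p₂) p₁≋ (≋-sym (vec p₂) x p₂≋) }
      ; C2    = λ a 0<Euc qa≉0 →
          -- The closed-loop successor is the witness: it is nonzero because the degree is at least
          -- the positive `Euc a`.
          let x   = degree q a · (vec q ∘ matrix a)
              p   = x , ·-nonzero (degree q a) (vec q ∘ matrix a)
                      (<-≤-trans (Euc a) (degree q a) 0<Euc (admissible q a)) qa≉0
              p∈P = P-closed {q} {a} {p} q∈P (≋-refl x)
          in p , p∈P , p∈P , ≋-refl x
      }

    prepend : ∀ {q a r p} → q ∈ P → (a , r) ∈ C q →
              Path (startingAt r) Euc P C p → Path (startingAt q) Euc P C p
    prepend {q} {a} {r} q∈P r∈C path = record
      { k      = ℕ.suc k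
      ; state  = q ∷ state
      ; event  = a ∷ event
      ; start  = ≋-refl (vec q)
      ; end    = end
      ; source = λ { zero → q∈P ; (suc i) → source i }
      -- The given path starts at a state only equivalent to `r`, so the new transition is
      -- transported there.
      ; step   = λ { zero → C-resp {q} {q} {a} {r} {head state} (≋-refl (vec q))
                              (≋-sym (vec (head state)) (vec r) start) r∈C
                   ; (suc i) → step i }
      }
      where open Path path

    -- Strings grow at the end, paths are extended at the front: the last transition of the string
    -- moves to the front of the path until the string is empty.
    concat : ∀ {q s r p} → δᶠ* q s r → (∀ {s r} → δᶠ* q s r → r ∈ P) →
             Path (startingAt r) Euc P C p → Path (startingAt q) Euc P C p
    concat {q} {r = r} (empty r≈q) reach path = record
      { k = k ; state = state ; event = event
      ; start = ≋-trans (vec (head state)) (vec r) (vec q) start r≈q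
      ; end = end ; source = source ; step = step }
      where open Path path
    concat {r = r} (snoc {r = r₀} {a} d r₀→r) reach path =
      concat d reach (prepend {r₀} {a} {r} (reach d) (reach (snoc d r₀→r) , r₀→r) path)

    controllable : Controllable G Euc P
    controllable = record
      { C          = C
      ; C-resp     = λ {q} {q′} {a} {p} {p′} → C-resp {q} {q′} {a} {p} {p′}
      ; compatible = compatible
      ; path       = λ {p} p∈P →
          concat (proj₂ (proj₂ R≐P p∈P)) (λ d → proj₁ R≐P (_ , d)) record
            { k = 0 ; state = λ _ → p ; event = λ () ; start = ≋-refl (vec p)
            ; end = ≋-refl (vec p) ; source = λ () ; step = λ () }
      }

  -- From a selection to a controller.

  module FromSelection (em : ExcludedMiddle (lsuc 0ℓ)) (P≠∅ : Satisfiable P)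
                       (controllable : Controllable G Euc P) where

    open Supremum em
    open Controllable controllable

    Realising : State n → Event → Pred 𝕀 (lsuc 0ℓ)
    Realising q a α = ∃[ p ] (a , p) ∈ C q × α · (vec q ∘ matrix a) ≋ vec p

    Realising-resp : ∀ {q q′} → q ≈ₛ q′ → ∀ a {α} →
                     α ∈ Realising q a → α ∈ Realising q′ a
    Realising-resp {q} {q′} q≈q′ a {α} (p , p∈C , αqa≋p) =
      p , C-resp {q} {q′} {a} {p} {p} q≈q′ (≋-refl (vec p)) p∈C ,
      ≋-trans (α · (vec q′ ∘ matrix a)) (α · (vec q ∘ matrix a)) (vec p)
        (·-cong α α (vec q′ ∘ matrix a) (vec q ∘ matrix a) (id , id)
          (∘-congˡ (vec q′) (vec q) (matrix a) (≋-sym (vec q) (vec q′) q≈q′)))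
        αqa≋p

    -- The join secures admissibility. If nothing is selected for `a` at `q`, the supremum is empty
    -- and only `Euc a` remains.
    degree : State n → Event → 𝕀
    degree q a = Euc a ∨ sup (Realising q a)

    -- By `C-resp`, equivalent states have the same realising degrees, whereas degrees picked state
    -- by state might disagree.
    degree-mono : ∀ {q q′} → q ≈ₛ q′ → ∀ a → degree q a ≤ degree q′ a
    degree-mono {q} {q′} q≈q′ a =
      [ inj₁
      , (λ r∈sup → inj₂ (sup-least (Realising q a) (sup (Realising q′ a))
          (λ α α∈ → sup-upper (Realising q′ a) α (Realising-resp {q} {q′} q≈q′ a {α} α∈)) r∈sup))
      ]

    f : FSFC G Euc
    f = record
      { degree     = degree
      ; cong       = λ {q} {q′} q≈q′ a →
          degree-mono {q} {q′} q≈q′ a ,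
          degree-mono {q′} {q} (≋-sym (vec q) (vec q′) q≈q′) a
      ; admissible = λ q a → inj₁
      }

    open ClosedLoop G Euc f

    selected⇒δᶠ : ∀ {q a p} → q ∈ P → (a , p) ∈ C q → δᶠ q a p
    selected⇒δᶠ {q} {a} {p} q∈P p∈C i = p≤ , ≤p
      where
      open Compatible (compatible q∈P)
      qa = vec q ∘ matrix a

      -- A degree that realises `p`: it lies below the supremum, which gives `p≤`, and above
      -- `Euc a`, which gives `Euc≤`.
      α = proj₁ (proj₂ (⊆Succ p∈C))
      Euc≤α = proj₁ (proj₂ (proj₂ (⊆Succ p∈C)))
      αqa≋p = proj₂ (proj₂ (proj₂ (⊆Succ p∈C)))

      p≤ : vec p i ≤ degree q a ∧ qa i
      p≤ r∈p = let r∈α , r∈qa = proj₂ (αqa≋p i) r∈p in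
        inj₂ (sup-upper (Realising q a) α (p , p∈C , αqa≋p) r∈α) , r∈qa

      Euc≤ : Euc a ∧ qa i ≤ vec p i
      Euc≤ (r∈Euc , r∈qa) = proj₁ (αqa≋p i) (Euc≤α r∈Euc , r∈qa)

      sup≤ : sup (Realising q a) ∧ qa i ≤ vec p i
      sup≤ = sup-∧-least (Realising q a) (qa i) (vec p i)
        λ β (p′ , p′∈C , βqa≋p′) r∈ → proj₁ (C1 p′∈C p∈C refl i) (proj₁ (βqa≋p′ i) r∈)

      ≤p : degree q a ∧ qa i ≤ vec p i
      ≤p (inj₁ r∈Euc , r∈qa) = Euc≤ (r∈Euc , r∈qa)
      ≤p (inj₂ r∈sup , r∈qa) = sup≤ (r∈sup , r∈qa)

    -- With nothing selected for `a`, the degree is `Euc a`. As `p` is nonzero, both `Euc a` and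
    -- `vec q ∘ matrix a` are then nonzero, so `C2` applies.
    δᶠ⇒selected : ∀ {q a p} → q ∈ P → δᶠ q a p → ∃[ p′ ] (a , p′) ∈ C q
    δᶠ⇒selected {q} {a} {p} q∈P p≋ with em {∃[ p′ ] (a , p′) ∈ C q}
    ... | yes selected   = selected
    ... | no  unselected = let p′ , _ , p′∈C = C2 a 0<Euc qa≉0 in p′ , p′∈C
      where
      open Compatible (compatible q∈P)

      qa≉0 : ¬ IsZero (vec q ∘ matrix a)
      qa≉0 qa≈0 = State.nonzero p (≤0⇒IsZero (vec p) λ i r∈p →
        proj₁ (qa≈0 i) (proj₂ (proj₁ (p≋ i) r∈p)))

      sup≤0 : sup (Realising q a) ≤ 0𝕀
      sup≤0 = sup-least (Realising q a) 0𝕀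
        λ _ (p′ , p′∈C , _) → ⊥-elim (unselected (p′ , p′∈C))

      0<Euc : 0𝕀 < Euc a
      0<Euc = 𝕀.0≤ (Euc a) , λ (_ , Euc≤0) →
        State.nonzero p (≤0⇒IsZero (vec p) λ i r∈p →
          [ Euc≤0 , sup≤0 ] (proj₁ (proj₁ (p≋ i) r∈p)))

    -- Nonemptiness of `P` provides a path, and every path begins at `q₀`.
    q₀∈P : q₀ ∈ P
    q₀∈P = go (path (proj₂ P≠∅))
      where
      p = proj₁ P≠∅

      go : Path G Euc P C p → q₀ ∈ P
      -- Here `source` is vacuous, but the start is also the end, which is in `P`.
      go record { k = ℕ.zero ; state = state ; start = start ; end = end } =
        let r = state zero in
        P-resp {r} {q₀} start (P-resp {p} {r} (≋-sym (vec r) (vec p) end) (proj₂ P≠∅))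
      go record { k = ℕ.suc _ ; state = state ; start = start ; source = source } =
        P-resp {state zero} {q₀} start (source zero)

    reachable⇒P : ∀ {s p} → δᶠ* q₀ s p → p ∈ P
    reachable⇒P {p = p} (empty p≈q₀) = P-resp {q₀} {p} (≋-sym (vec p) (vec q₀) p≈q₀) q₀∈P
    reachable⇒P {p = p} (snoc {r = r} {a} d p≋) =
      let r∈P       = reachable⇒P d
          -- The selected `p′` is not known to be `p`, but `selected⇒δᶠ` equates both with `x`.
          p′ , p′∈C = δᶠ⇒selected {r} {a} {p} r∈P p≋
          x         = degree r a · (vec r ∘ matrix a)
          p′≋       = selected⇒δᶠ {r} {a} {p′} r∈P p′∈C
      in P-resp {p′} {p} (≋-trans (vec p′) x (vec p) p′≋ (≋-sym (vec p) x p≋))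
           (proj₁ (Compatible.⊆Succ (compatible r∈P) p′∈C))

    Reachable-resp : Reachable Respects _≈ₛ_
    Reachable-resp {p} {p′} p≈p′ (_ , empty p≈q₀) =
      _ , empty (≋-trans (vec p′) (vec p) (vec q₀) (≋-sym (vec p) (vec p′) p≈p′) p≈q₀)
    Reachable-resp {p} {p′} p≈p′ (_ , snoc {r = r} {a} d p≋) =
      _ , snoc {r = r} {a} {p′} d
            (≋-trans (vec p′) (vec p) (degree r a · (vec r ∘ matrix a))
              (≋-sym (vec p) (vec p′) p≈p′) p≋)

    -- The induction drops the first step, so the start varies and its reachability is carried
    -- along.
    path⇒reachable : ∀ {k} (state : Fin (ℕ.suc k) → State n) (event : Fin k → Event) →
      (∀ i → state (inject₁ i) ∈ P) →
      (∀ i → (event i , state (suc i)) ∈ C (state (inject₁ i))) →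
      state zero ∈ Reachable → state (fromℕ k) ∈ Reachable
    path⇒reachable {ℕ.zero}  state event source step reach = reach
    path⇒reachable {ℕ.suc k} state event source step (_ , d) =
      path⇒reachable (tail state) (tail event)
        (λ i → source (suc i)) (λ i → step (suc i))
        (_ , snoc d (selected⇒δᶠ {state zero} {event zero} {state (suc zero)}
                      (source zero) (step zero)))

    R≐P : Reachable ≐ P
    R≐P = (λ (_ , d) → reachable⇒P d) , λ {p} p∈P →
      let open Path (path p∈P) in
      Reachable-resp {state (fromℕ k)} {p} end
        (path⇒reachable state event source step (_ , empty start))

theorem2 : ExcludedMiddle (lsuc 0ℓ) →
    (n : ℕ) → .{{_ : NonZero n}} →
    (G : FuzzyDES n) (Euc : FuzzyDES.Event G → 𝕀) →
    (P : Pred (State n) (lsuc 0ℓ)) → P Respects _≈ₛ_ → Satisfiable P →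
    (∃[ f ] ClosedLoop.Reachable G Euc f ≐ P) ⇔ Controllable G Euc P
theorem2 em n G Euc P P-resp P≠∅ = mk⇔
  (λ (f , R≐P) → FromController.controllable G Euc P P-resp f R≐P)
  (λ controllable → let open FromSelection G Euc P P-resp em P≠∅ controllable in f , R≐P)
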